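{- Consider $n$-chains for integers $n\geqslant 4$. Then the following hold, where $\|$ denotes a (possibly empty) list of zeroes whose length is such that the whole tuple has exactly $n$ components. The perfect chains are exactly: $$(1,2,1,0)\ (n=4),\qquad (2,0,2,0)\ (n=4),\qquad (2,1,2,0,0)\ (n=5),$$ $$(n-4,\,2,\,1\,\|\,1,0,0,0)\quad\text{for each } n\geqslant 7.$$ The (unordered) pairs of amicable chains are exactly: $$\{(2,3,0,1,0,0),\ (3,1,1,1,0,0)\}\ (n=6),$$ $$\{(n-4,\,3,\,0,\,0\,\|\,0,1,0,0),\ (n-3,\,1,\,0,\,1\,\|\,1,0,0,0)\}\quad\text{for each } n\geqslant 8.$$ The unique group of sociable chains (up to cyclic rotation of the listing) is, for $n=7$, $$(3,3,0,0,1,0,0),\quad (4,1,0,2,0,0,0),\quad (4,1,1,0,1,0,0).$$ There is no group of more than $3$ sociable chains.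
   Context: For an integer $n\geqslant 1$ let $N=\{0,1,\ldots,n-1\}$. An $n$-chain is an $n$-tuple $\mathbf{x}=(x_0,x_1,\ldots,x_{n-1})$ with $x_i\in N$ for all $i\in N$; the set of all $n$-chains is denoted $N^N$. The counting operator $s:N^N\to\{0,1,\ldots,n\}^N$ is defined by $s(\mathbf{x})=\mathbf{x}'$ with $x'_j=|\{i\in N : x_i=j\}|$ for $j\in N$. An $n$-chain $\mathbf{x}$ is perfect if $s(\mathbf{x})=\mathbf{x}$. Two $n$-chains $\mathbf{x}\neq\mathbf{x}'$ form a pair of amicable chains if $s(\mathbf{x})=\mathbf{x}'$ and $s(\mathbf{x}')=\mathbf{x}$. For an integer $l\geqslant 3$, $n$-chains $\mathbf{x}^{(0)},\ldots,\mathbf{x}^{(l-1)}\in N^N$ with $\mathbf{x}^{(k+1)}=s(\mathbf{x}^{(k)})$ for $k\in\{0,\ldots,l-2\}$ form a group of $l$ sociable chains if they are distinct and $s(\mathbf{x}^{(l-1)})=\mathbf{x}^{(0)}$. -}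

module Defs where

open import Data.Fin using (Fin; toℕ; fromℕ<; inject₁; _≟_)
open import Data.List using (List; []; _∷_; _++_; length; replicate)
open import Data.Nat using (ℕ; suc; _+_; _∸_; _≥_; s≤s)
open import Data.Product using (_×_; ∃-syntax)
open import Data.Vec using (Vec; map; tabulate; count; toList)
open import Data.Vec.Properties using (count≤n)
open import Function.Definitions using (Injective)
open import Relation.Binary.PropositionalEquality using (_≡_; _≢_)

Chain : ℕ → Set
Chain n = Vec (Fin n) n

s : ∀ {n} → Chain n → Vec (Fin (suc n)) n
s x = tabulate λ j → fromℕ< (s≤s (count≤n (_≟ j) x))

-- x ↦ₛ y is s(x) = y, where y ∈ Nᴺ is regarded as an element of {0,…,n}ᴺ.
infix 4 _↦ₛ_
_↦ₛ_ : ∀ {n} → Chain n → Chain n → Set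
x ↦ₛ y = s x ≡ map inject₁ y

Perfect : ∀ {n} → Chain n → Set
Perfect x = x ↦ₛ x

Amicable : ∀ {n} → Chain n → Chain n → Set
Amicable x y = x ≢ y × x ↦ₛ y × y ↦ₛ x

record Sociable {n l : ℕ} (x : Fin l → Chain n) : Set where
  field
    l≥3      : l ≥ 3
    distinct : Injective _≡_ _≡_ x
    step     : ∀ i j → toℕ j ≡ suc (toℕ i) → x i ↦ₛ x j
    close    : ∀ i j → suc (toℕ i) ≡ l → toℕ j ≡ 0 → x i ↦ₛ x j

entries : ∀ {n} → Chain n → List ℕ
entries x = toList (map toℕ x)

-- The tuple (us ∥ vs) with n components. The subtraction is truncated, so this
-- has length n only when length us + length vs ≤ n.
pad : ℕ → List ℕ → List ℕ → List ℕ
pad n us vs = us ++ replicate (n ∸ (length us + length vs)) 0 ++ vs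

data PerfectTuple : ℕ → List ℕ → Set where
  perfect₄  : PerfectTuple 4 (1 ∷ 2 ∷ 1 ∷ 0 ∷ [])
  perfect₄′ : PerfectTuple 4 (2 ∷ 0 ∷ 2 ∷ 0 ∷ [])
  perfect₅  : PerfectTuple 5 (2 ∷ 1 ∷ 2 ∷ 0 ∷ 0 ∷ [])
  perfectₙ  : ∀ {n} → n ≥ 7 →
              PerfectTuple n (pad n (n ∸ 4 ∷ 2 ∷ 1 ∷ []) (1 ∷ 0 ∷ 0 ∷ 0 ∷ []))

data AmicableTuples : ℕ → List ℕ → List ℕ → Set where
  amicable₆ : AmicableTuples 6 (2 ∷ 3 ∷ 0 ∷ 1 ∷ 0 ∷ 0 ∷ []) (3 ∷ 1 ∷ 1 ∷ 1 ∷ 0 ∷ 0 ∷ [])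
  amicableₙ : ∀ {n} → n ≥ 8 →
              AmicableTuples n (pad n (n ∸ 4 ∷ 3 ∷ 0 ∷ 0 ∷ []) (0 ∷ 1 ∷ 0 ∷ 0 ∷ []))
                               (pad n (n ∸ 3 ∷ 1 ∷ 0 ∷ 1 ∷ []) (1 ∷ 0 ∷ 0 ∷ 0 ∷ []))

sociable₇ : List (List ℕ)
sociable₇ = (3 ∷ 3 ∷ 0 ∷ 0 ∷ 1 ∷ 0 ∷ 0 ∷ [])
          ∷ (4 ∷ 1 ∷ 0 ∷ 2 ∷ 0 ∷ 0 ∷ 0 ∷ [])
          ∷ (4 ∷ 1 ∷ 1 ∷ 0 ∷ 1 ∷ 0 ∷ 0 ∷ [])
          ∷ []

IsRotation : {A : Set} → List A → List A → Set
IsRotation xs ys = ∃[ as ] ∃[ bs ] (xs ≡ as ++ bs × ys ≡ bs ++ as)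

{-# OPTIONS --safe #-}
module Submission where

-- Let m(x) be the number of nonzero entries of x, and let x ↦ y ↦ z in a set of
-- chains in which every member has a predecessor. Then y₀ = n - m(x), and
-- y₁, …, yₙ₋₁ sum to m(x). The number m(z) counts the distinct values of y;
-- apart from 0 and y₀ these are distinct positive numbers of sum at most m(x), so
-- d(d+1)/2 ≤ m(x) for some d ≥ m(z) - 2. Hence a common bound K ≥ 5 on m can be
-- lowered to K - 1, and m ≤ 4 throughout.
--
-- Now the nonzero entries of a member are n - m followed by a composition of some
-- m ≤ 4, which leaves 15 candidates. Six steps of the counting operator take each
-- of them into one of the listed cycles; for n ≥ 11 the computation is uniform in
-- n because the entry n - m never coincides with another one.

open import Defs
open import Data.Bool using (if_then_else_; true; false)
open import Data.Fin using (Fin; zero; suc; toℕ; fromℕ; fromℕ<; inject₁)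
import Data.Fin as Fin
open import Data.Fin.Properties using (toℕ<n; toℕ-fromℕ; toℕ-fromℕ<; toℕ-inject₁; toℕ-injective)
open import Data.List using (List; []; _∷_; _++_; applyUpTo; concatMap; length; map; replicate; tabulate)
open import Data.List.Membership.DecPropositional using () renaming (_∈?_ to member?)
open import Data.List.Membership.Propositional using (_∈_; lose)
open import Data.List.Membership.Propositional.Properties using (∈-concatMap⁺; ∈-map⁺)
open import Data.List.Properties using (∷-injectiveˡ; ∷-injectiveʳ; length-++; length-replicate; ≡-dec)
open import Data.List.Relation.Unary.All using (All; []; _∷_; all?; lookup)
import Data.List.Relation.Unary.All as All
open import Data.List.Relation.Unary.All.Properties using (++⁺; replicate⁺)
open import Data.List.Relation.Unary.Any using (here; there)
open import Data.Nat using (ℕ; zero; suc; _+_; _*_; _∸_; _≡ᵇ_; _≤_; _<_; _≥_; _>_; z≤n; s≤s)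
open import Data.Nat.GeneralisedArithmetic using (iterate)
open import Data.Nat.ListAction using (sum)
open import Data.Nat.Properties
open import Data.Product using (_×_; _,_; proj₂; ∃-syntax; Σ-syntax)
open import Data.Product.Properties using () renaming (≡-dec to ×-≡-dec)
open import Data.Sum using (_⊎_; inj₁; inj₂)
open import Data.Unit using (⊤; tt)
open import Data.Vec using (Vec; []; _∷_; count; toList)
import Data.Vec as Vec
open import Data.Vec.Properties using (length-toList)
import Data.Vec.Properties as Vec
open import Function.Base using (_∘_; case_of_)
open import Function.Bundles using (_⇔_; mk⇔)
open import Relation.Binary.PropositionalEquality using (_≡_; _≢_; _≗_; refl; sym; trans; cong; cong₂; subst; module ≡-Reasoning)
open import Relation.Nullary using (¬_; Dec; yes; does; contradiction)
open import Relation.Nullary.Decidable using (True; _×-dec_; from-yes; toWitness)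

-- Occurrence counts

nonzeros : List ℕ → List ℕ
nonzeros []           = []
nonzeros (zero  ∷ vs) = nonzeros vs
nonzeros (suc v ∷ vs) = suc v ∷ nonzeros vs

occ : ℕ → List ℕ → ℕ
occ j []       = 0
occ j (v ∷ vs) = if v ≡ᵇ j then suc (occ j vs) else occ j vs

-- The value 0 is left out, so zeroes in `vs` do not affect the tally and it can be computed from
-- the nonzero entries alone.
tally : List ℕ → ℕ → List ℕ
tally vs = applyUpTo λ j → occ (suc j) vs

-- The list s(x) when vs are the nonzero entries of the n-chain x.
profile : ℕ → List ℕ → List ℕ
profile zero    vs = []
profile (suc q) vs = suc q ∸ length vs ∷ tally vs q

coreStep : ℕ → List ℕ → List ℕ
coreStep n vs = nonzeros (profile n vs)

-- Prepending `suc p` to a list turns its tally into a bumped one definitionally, because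
-- `suc p ≡ᵇ suc j` reduces to `p ≡ᵇ j`. Inductions on a list thus become statements about raising
-- one cell.
bump : ℕ → (ℕ → ℕ) → ℕ → ℕ
bump p f j = if p ≡ᵇ j then suc (f j) else f j

applyUpTo-cong : ∀ {f g : ℕ → ℕ} → f ≗ g → applyUpTo f ≗ applyUpTo g
applyUpTo-cong f≗g zero    = refl
applyUpTo-cong f≗g (suc q) = cong₂ _∷_ (f≗g 0) (applyUpTo-cong (f≗g ∘ suc) q)

occ-nonzeros : ∀ j vs → occ (suc j) (nonzeros vs) ≡ occ (suc j) vs
occ-nonzeros j []           = refl
occ-nonzeros j (zero  ∷ vs) = occ-nonzeros j vs
occ-nonzeros j (suc v ∷ vs) with v ≡ᵇ j
... | true  = cong suc (occ-nonzeros j vs)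
... | false = occ-nonzeros j vs

tally-nonzeros : ∀ vs q → tally (nonzeros vs) q ≡ tally vs q
tally-nonzeros vs = applyUpTo-cong λ j → occ-nonzeros j vs

occ-zero : ∀ vs → occ 0 vs + length (nonzeros vs) ≡ length vs
occ-zero []           = refl
occ-zero (zero  ∷ vs) = cong suc (occ-zero vs)
occ-zero (suc v ∷ vs) = trans (+-suc (occ 0 vs) _) (cong suc (occ-zero vs))

length-nonzeros : ∀ vs → length (nonzeros vs) ≤ length vs
length-nonzeros vs = ≤-trans (m≤n+m _ (occ 0 vs)) (≤-reflexive (occ-zero vs))

sum-nonzeros : ∀ vs → sum (nonzeros vs) ≡ sum vs
sum-nonzeros []           = refl
sum-nonzeros (zero  ∷ vs) = sum-nonzeros vs
sum-nonzeros (suc v ∷ vs) = cong (suc v +_) (sum-nonzeros vs)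

nonzeros-positive : ∀ vs → All (0 <_) (nonzeros vs)
nonzeros-positive []           = []
nonzeros-positive (zero  ∷ vs) = nonzeros-positive vs
nonzeros-positive (suc v ∷ vs) = s≤s z≤n ∷ nonzeros-positive vs

nonzeros⁺ : ∀ {P : ℕ → Set} {vs} → All P vs → All P (nonzeros vs)
nonzeros⁺ []                     = []
nonzeros⁺ {vs = zero  ∷ _} (_ ∷ ps) = nonzeros⁺ ps
nonzeros⁺ {vs = suc _ ∷ _} (p ∷ ps) = p ∷ nonzeros⁺ ps

nonzeros-replicate : ∀ k vs → nonzeros (replicate k 0 ++ vs) ≡ nonzeros vs
nonzeros-replicate zero    vs = refl
nonzeros-replicate (suc k) vs = nonzeros-replicate k vs

nonzeros-idem : ∀ vs → nonzeros (nonzeros vs) ≡ nonzeros vs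
nonzeros-idem []           = refl
nonzeros-idem (zero  ∷ vs) = nonzeros-idem vs
nonzeros-idem (suc v ∷ vs) = cong (suc v ∷_) (nonzeros-idem vs)

sum-bump : ∀ {p q} → p < q → ∀ f → sum (applyUpTo (bump p f) q) ≡ suc (sum (applyUpTo f q))
sum-bump {zero}  {suc q} _         f = refl
sum-bump {suc p} {suc q} (s≤s p<q) f =
  trans (cong (f 0 +_) (sum-bump p<q (f ∘ suc))) (+-suc (f 0) _)

-- Every element lies between 1 and `q`, so it raises exactly one of the `q` cells.
sum-tally : ∀ {q vs} → All (0 <_) vs → All (_< suc q) vs → sum (tally vs q) ≡ length vs
sum-tally {q} [] [] = go q
  where
  go : ∀ q → sum (tally [] q) ≡ 0
  go zero    = refl
  go (suc q) = go q
sum-tally {q} {suc v ∷ vs} (_ ∷ ps) (s≤s v<q ∷ bs) =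
  trans (sum-bump v<q λ j → occ (suc j) vs) (cong suc (sum-tally ps bs))

-- The bound on the number of nonzero entries

support : List ℕ → ℕ
support cs = length (nonzeros cs)

support-bump : ∀ p f q → support (applyUpTo (bump p f) q) ≤ suc (support (applyUpTo f q))
support-bump p f zero = z≤n
support-bump zero f (suc q) with f 0
... | zero  = ≤-refl
... | suc _ = n≤1+n _
support-bump (suc p) f (suc q) with f 0
... | zero  = support-bump p (f ∘ suc) q
... | suc _ = s≤s (support-bump p (f ∘ suc) q)

support-tally-∷ : ∀ v vs q → support (tally (v ∷ vs) q) ≤ suc (support (tally vs q))
support-tally-∷ zero    vs q = n≤1+n _
support-tally-∷ (suc v) vs q = support-bump v (λ j → occ (suc j) vs) q

support-∷ : ∀ v vs → support (v ∷ vs) ≤ suc (support vs)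
support-∷ zero    vs = n≤1+n _
support-∷ (suc v) vs = ≤-refl

-- With `o = 1` and a tally for `cs`, cell by cell this is value times multiplicity; a general `o`
-- is needed for the induction along the cells.
weightedSum : ℕ → List ℕ → ℕ
weightedSum o []       = 0
weightedSum o (c ∷ cs) = o * c + weightedSum (suc o) cs

weightedSum-bump : ∀ o p f q →
  weightedSum o (applyUpTo (bump p f) q) ≤ o + p + weightedSum o (applyUpTo f q)
weightedSum-bump o p f zero = z≤n
weightedSum-bump o zero f (suc q) = ≤-reflexive (begin
  o * suc (f 0) + w         ≡⟨ cong (_+ w) (*-suc o (f 0)) ⟩
  o + o * f 0 + w           ≡⟨ +-assoc o _ w ⟩
  o + (o * f 0 + w)         ≡⟨ cong (_+ (o * f 0 + w)) (+-identityʳ o) ⟨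
  o + 0 + (o * f 0 + w)     ∎)
  where
  open ≡-Reasoning
  w = weightedSum (suc o) (applyUpTo (f ∘ suc) q)
weightedSum-bump o (suc p) f (suc q) = begin
  o * f 0 + weightedSum (suc o) (applyUpTo (bump p (f ∘ suc)) q)
    ≤⟨ +-monoʳ-≤ (o * f 0) (weightedSum-bump (suc o) p (f ∘ suc) q) ⟩
  o * f 0 + (suc o + p + w)
    ≡⟨ cong (λ t → o * f 0 + (t + w)) (+-suc o p) ⟨
  o * f 0 + (o + suc p + w)
    ≡⟨ x∙yz≈y∙xz (o * f 0) (o + suc p) w ⟩
  o + suc p + (o * f 0 + w)
    ∎
  where
  open ≤-Reasoning
  open import Algebra.Properties.CommutativeSemigroup +-commutativeSemigroup using (x∙yz≈y∙xz)
  w = weightedSum (suc o) (applyUpTo (f ∘ suc) q)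

-- Values above `q` have no cell and are lost, hence an inequality.
weightedSum-tally : ∀ vs q → weightedSum 1 (tally vs q) ≤ sum vs
weightedSum-tally [] q = go 1 q
  where
  go : ∀ o q → weightedSum o (tally [] q) ≤ 0
  go o zero    = z≤n
  go o (suc q) = subst (λ t → t + weightedSum (suc o) (tally [] q) ≤ 0) (sym (*-zeroʳ o)) (go (suc o) q)
weightedSum-tally (zero  ∷ vs) q = weightedSum-tally vs q
weightedSum-tally (suc v ∷ vs) q =
  ≤-trans (weightedSum-bump 1 v (λ j → occ (suc j) vs) q) (+-monoʳ-≤ (suc v) (weightedSum-tally vs q))

-- This is d(d-1)/2, so that `d + triangle d` is d(d+1)/2.
triangle : ℕ → ℕ
triangle zero    = 0
triangle (suc d) = d + triangle d

-- d distinct values, each at least o, add up to at least o + (o + 1) + ⋯ + (o + d - 1).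
triangle-support : ∀ o cs → o * support cs + triangle (support cs) ≤ weightedSum o cs
triangle-support o [] = ≤-reflexive (trans (+-identityʳ _) (*-zeroʳ o))
triangle-support o (zero ∷ cs) = begin
  o * d + triangle d             ≤⟨ +-monoˡ-≤ (triangle d) (*-monoˡ-≤ d (n≤1+n o)) ⟩
  suc o * d + triangle d         ≤⟨ triangle-support (suc o) cs ⟩
  weightedSum (suc o) cs         ≤⟨ m≤n+m _ (o * 0) ⟩
  o * 0 + weightedSum (suc o) cs ∎
  where
  open ≤-Reasoning
  d = support cs
triangle-support o (suc c ∷ cs) = begin
  o * suc d + (d + triangle d)       ≡⟨ cong (_+ (d + triangle d)) (*-suc o d) ⟩
  o + o * d + (d + triangle d)       ≡⟨ +-assoc o (o * d) _ ⟩
  o + (o * d + (d + triangle d))     ≡⟨ cong (o +_) (+-assoc (o * d) d _) ⟨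
  o + (o * d + d + triangle d)       ≡⟨ cong (λ t → o + (t + triangle d)) (+-comm (o * d) d) ⟩
  o + (suc o * d + triangle d)       ≤⟨ +-mono-≤ o≤o*c (triangle-support (suc o) cs) ⟩
  o * suc c + weightedSum (suc o) cs ∎
  where
  open ≤-Reasoning
  d = support cs
  o≤o*c : o ≤ o * suc c
  o≤o*c = subst (o ≤_) (sym (*-suc o c)) (m≤m+n o (o * c))

triangle-support-tally : ∀ vs q →
  support (tally vs q) + triangle (support (tally vs q)) ≤ sum vs
triangle-support-tally vs q = begin
  d + triangle d             ≡⟨ cong (_+ triangle d) (*-identityˡ d) ⟨
  1 * d + triangle d         ≤⟨ triangle-support 1 (tally vs q) ⟩
  weightedSum 1 (tally vs q) ≤⟨ weightedSum-tally vs q ⟩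
  sum vs                     ∎
  where
  open ≤-Reasoning
  d = support (tally vs q)

length-coreStep² : ∀ q e vs → All (0 <_) vs → All (_< suc q) vs → length vs ≤ 5 + e →
  length (coreStep (suc q) (coreStep (suc q) vs)) ≤ 4 + e
length-coreStep² q e vs pos bnd |vs|≤5+e =
  ≤-trans length≤2+d (bound d (triangle-support-tally (tally vs q) q))
  where
  open ≤-Reasoning
  h = suc q ∸ length vs
  d = support (tally (tally vs q) q)

  -- The 2 allows for the zero count produced by the second step and for the value `h`, which may
  -- differ from every value in `tally vs q`.
  length≤2+d : length (coreStep (suc q) (coreStep (suc q) vs)) ≤ 2 + d
  length≤2+d = begin
    length (coreStep (suc q) (nonzeros (h ∷ tally vs q)))
      ≤⟨ support-∷ (suc q ∸ length (nonzeros (h ∷ tally vs q))) _ ⟩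
    suc (support (tally (nonzeros (h ∷ tally vs q)) q))
      ≡⟨ cong (suc ∘ support) (tally-nonzeros (h ∷ tally vs q) q) ⟩
    suc (support (tally (h ∷ tally vs q) q))
      ≤⟨ s≤s (support-tally-∷ h (tally vs q) q) ⟩
    2 + d
      ∎

  3≤triangle : ∀ d → 3 ≤ triangle (3 + d)
  3≤triangle d = s≤s (s≤s (≤-trans (s≤s z≤n) (m≤n+m _ d)))

  -- For d ≤ 2 the bound 4 holds outright. From d = 3 on, `triangle d` is at least 3, which gives d
  -- + 3 ≤ 5 + e.
  bound : ∀ d → d + triangle d ≤ sum (tally vs q) → 2 + d ≤ 4 + e
  bound 0 _ = s≤s (s≤s z≤n)
  bound 1 _ = s≤s (s≤s (s≤s z≤n))
  bound 2 _ = s≤s (s≤s (s≤s (s≤s z≤n)))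
  bound (suc (suc (suc d))) le = ≤-pred (begin
    3 + (3 + d)                 ≡⟨ +-comm 3 (3 + d) ⟩
    3 + d + 3                   ≤⟨ +-monoʳ-≤ (3 + d) (3≤triangle d) ⟩
    3 + d + triangle (3 + d)    ≤⟨ le ⟩
    sum (tally vs q)            ≡⟨ sum-tally pos bnd ⟩
    length vs                   ≤⟨ |vs|≤5+e ⟩
    5 + e                       ∎)

-- The counting operator on lists of entries

core : ∀ {n} → Chain n → List ℕ
core x = nonzeros (entries x)

does-≟ : ∀ {n} (i j : Fin n) → does (i Fin.≟ j) ≡ (toℕ i ≡ᵇ toℕ j)
does-≟ zero    zero    = refl
does-≟ zero    (suc j) = refl
does-≟ (suc i) zero    = refl
does-≟ (suc i) (suc j) = does-≟ i j

count-occ : ∀ {m n} (x : Vec (Fin n) m) j → count (Fin._≟ j) x ≡ occ (toℕ j) (toList (Vec.map toℕ x))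
count-occ []      j = refl
count-occ (i ∷ x) j rewrite does-≟ i j with toℕ i ≡ᵇ toℕ j
... | true  = cong suc (count-occ x j)
... | false = count-occ x j

toList-tabulate : ∀ {n} (f : ℕ → ℕ) → toList (Vec.tabulate {n = n} (f ∘ toℕ)) ≡ applyUpTo f n
toList-tabulate {zero}  f = refl
toList-tabulate {suc n} f = cong (f 0 ∷_) (toList-tabulate (f ∘ suc))

length-entries : ∀ {n} (x : Chain n) → length (entries x) ≡ n
length-entries x = length-toList (Vec.map toℕ x)

entries-bounded : ∀ {n} (x : Chain n) → All (_< n) (entries x)
entries-bounded = go
  where
  go : ∀ {m n} (x : Vec (Fin n) m) → All (_< n) (toList (Vec.map toℕ x))
  go []      = []
  go (i ∷ x) = toℕ<n i ∷ go x

toℕs-injective : ∀ {m n} (x y : Vec (Fin n) m) →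
  toList (Vec.map toℕ x) ≡ toList (Vec.map toℕ y) → x ≡ y
toℕs-injective []      []      _  = refl
toℕs-injective (i ∷ x) (j ∷ y) eq =
  cong₂ _∷_ (toℕ-injective (∷-injectiveˡ eq)) (toℕs-injective x y (∷-injectiveʳ eq))

-- The zeroes of `x` are exactly the entries missing from `core x`, so their number is `n` minus its
-- length; the other counts ignore zeroes.
profile-core : ∀ {n} (x : Chain n) → toList (Vec.map toℕ (s x)) ≡ profile n (core x)
profile-core {n} x = trans (cong toList eq) (trans (toList-tabulate (λ j → occ j (entries x))) (split n refl))
  where
  eq : Vec.map toℕ (s x) ≡ Vec.tabulate (λ j → occ (toℕ j) (entries x))
  eq = trans (sym (Vec.tabulate-∘ toℕ _))
             (Vec.tabulate-cong λ j → trans (toℕ-fromℕ< _) (count-occ x j))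

  -- The separate `m` permits a case split on the length while the type of `x` stays fixed.
  split : ∀ m → m ≡ n → applyUpTo (λ j → occ j (entries x)) m ≡ profile m (core x)
  split zero    _   = refl
  split (suc q) q≡n = cong₂ _∷_
    (trans (sym (m+n∸n≡m (occ 0 (entries x)) (length (core x))))
           (cong (_∸ length (core x)) (trans (occ-zero (entries x)) (trans (length-entries x) (sym q≡n)))))
    (sym (tally-nonzeros (entries x) q))

map-toℕ-inject₁ : ∀ {m n} (y : Vec (Fin n) m) → Vec.map toℕ (Vec.map inject₁ y) ≡ Vec.map toℕ y
map-toℕ-inject₁ y = trans (sym (Vec.map-∘ toℕ inject₁ y)) (Vec.map-cong toℕ-inject₁ y)

-- With the converse `profile⇒↦ₛ`, this moves all later arguments from vectors over `Fin` to lists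
-- of naturals.
↦ₛ⇒profile : ∀ {n} (x y : Chain n) → x ↦ₛ y → entries y ≡ profile n (core x)
↦ₛ⇒profile x y x↦y =
  trans (cong toList (trans (sym (map-toℕ-inject₁ y)) (cong (Vec.map toℕ) (sym x↦y)))) (profile-core x)

profile⇒↦ₛ : ∀ {n} (x y : Chain n) → entries y ≡ profile n (core x) → x ↦ₛ y
profile⇒↦ₛ x y eq = toℕs-injective _ _
  (trans (profile-core x) (trans (sym eq) (cong toList (sym (map-toℕ-inject₁ y)))))

realise : ∀ {n} u → length u ≡ n → All (_< n) u → ∃[ x ] entries {n} x ≡ u
realise {n} u refl bnd = go u bnd
  where
  go : ∀ u → All (_< n) u → Σ[ x ∈ Vec (Fin n) (length u) ] toList (Vec.map toℕ x) ≡ u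
  go []      []       = [] , refl
  go (v ∷ u) (b ∷ bs) = let x , eq = go u bs in
    fromℕ< b ∷ x , cong₂ _∷_ (toℕ-fromℕ< b) eq

-- Compositions

-- A composition of m + 1 arises from one of m by enlarging the first part or by prepending a part
-- 1. The empty composition, for m = 0, allows only the latter.
compositions : ℕ → List (List ℕ)
compositions zero    = [] ∷ []
compositions (suc m) = concatMap extend (compositions m)
  where
  extend : List ℕ → List (List ℕ)
  extend []       = (1 ∷ []) ∷ []
  extend (v ∷ vs) = (suc v ∷ vs) ∷ (1 ∷ v ∷ vs) ∷ []

∈-compositions : ∀ {vs} → All (0 <_) vs → vs ∈ compositions (sum vs)
-- Recursion on the first part undoes `extend`: a first part 1 was prepended, a larger one was
-- enlarged.
∈-compositions-∷ : ∀ v {vs} → All (0 <_) vs → suc v ∷ vs ∈ compositions (suc v + sum vs)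
∈-compositions []                   = here refl
∈-compositions {suc v ∷ vs} (_ ∷ ps) = ∈-compositions-∷ v ps
∈-compositions-∷ zero {[]} [] = here refl
∈-compositions-∷ zero {v ∷ vs} ps =
  ∈-concatMap⁺ _ {xs = compositions (sum (v ∷ vs))} (lose (∈-compositions ps) (there (here refl)))
∈-compositions-∷ (suc v) {vs} ps =
  ∈-concatMap⁺ _ {xs = compositions (suc v + sum vs)} (lose (∈-compositions-∷ v ps) (here refl))

Shape : Set
Shape = ℕ × List ℕ

-- The shape (m , μ) stands for the nonzero entries of a chain whose
-- predecessor has m nonzero entries: x₀ = n - m, and the other entries sum to m.
word : ℕ → Shape → List ℕ
word n (m , μ) = n ∸ m ∷ μ

shapes : List Shape
shapes = concatMap (λ m → map (m ,_) (compositions m)) (1 ∷ 2 ∷ 3 ∷ 4 ∷ [])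

∈-shapes : ∀ {m μ} → All (0 <_) μ → sum μ ≡ m → 1 ≤ m → m ≤ 4 → (m , μ) ∈ shapes
∈-shapes {m} {μ} pos refl 1≤m m≤4 =
  ∈-concatMap⁺ (λ m → map (m ,_) (compositions m)) (lose (∈-1234 1≤m m≤4) (∈-map⁺ _ (∈-compositions pos)))
  where
  ∈-1234 : ∀ {m} → 1 ≤ m → m ≤ 4 → m ∈ 1 ∷ 2 ∷ 3 ∷ 4 ∷ []
  ∈-1234 {1} _ _ = here refl
  ∈-1234 {2} _ _ = there (here refl)
  ∈-1234 {3} _ _ = there (there (here refl))
  ∈-1234 {4} _ _ = there (there (there (here refl)))
  ∈-1234 {suc (suc (suc (suc (suc _))))} _ (s≤s (s≤s (s≤s (s≤s ()))))

-- Iterating from the candidates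

-- The perfect chain and the two amicable chains of the families in `n`, in this order. `cycleCores`
-- replaces them by explicit nonzero entries for the irregular values of `n` from 4 to 7.
cycleShapes : List Shape
cycleShapes = (4 , 2 ∷ 1 ∷ 1 ∷ []) ∷ (4 , 3 ∷ 1 ∷ []) ∷ (3 , 1 ∷ 1 ∷ 1 ∷ []) ∷ []

cycleCores : ℕ → List (List ℕ)
cycleCores 4 = (1 ∷ 2 ∷ 1 ∷ []) ∷ (2 ∷ 2 ∷ []) ∷ []
cycleCores 5 = (2 ∷ 1 ∷ 2 ∷ []) ∷ []
cycleCores 6 = (2 ∷ 3 ∷ 1 ∷ []) ∷ (3 ∷ 1 ∷ 1 ∷ 1 ∷ []) ∷ []
cycleCores 7 = (3 ∷ 2 ∷ 1 ∷ 1 ∷ []) ∷ (3 ∷ 3 ∷ 1 ∷ []) ∷ (4 ∷ 1 ∷ 2 ∷ []) ∷ (4 ∷ 1 ∷ 1 ∷ 1 ∷ []) ∷ []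
cycleCores n = map (word n) cycleShapes

-- Six steps suffice for every candidate and every n ≥ 4. The outer `nonzeros` matters when n = m =
-- 4, where the first entry of the word vanishes.
Settles : ℕ → Shape → Set
Settles n σ = iterate (coreStep n) (nonzeros (word n σ)) 6 ∈ cycleCores n

settles? : ∀ n → Dec (All (Settles n) shapes)
settles? n = all? (λ σ → member? (≡-dec _≟_) _ (cycleCores n)) shapes

-- The effect of a counting step on a word whose first entry exceeds 5 while all others are at most
-- 5: the final 1 counts that first entry.
nextShape : Shape → Shape
nextShape (m , μ) = suc (length μ) , nonzeros (tally μ 5) ++ 1 ∷ []

-- For n ≥ 11 the bounds by 5 keep the first entry at least 6 before and after a step, and above the
-- others. The condition 1 ≤ m puts n - m below n, so that some cell counts it.
Tame : Shape → Set
Tame (m , μ) = (1 ≤ m × m ≤ 5) × suc (length μ) ≤ 5 × All (_≤ 5) μ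

TameFor : ℕ → Shape → Set
TameFor zero    σ = ⊤
TameFor (suc t) σ = Tame σ × TameFor t (nextShape σ)

tameFor? : ∀ t σ → Dec (TameFor t σ)
tameFor? zero    σ       = yes tt
tameFor? (suc t) (m , μ) =
  ((1 ≤? m ×-dec m ≤? 5) ×-dec suc (length μ) ≤? 5 ×-dec all? (_≤? 5) μ) ×-dec tameFor? t _

nonzeros-zeros : ∀ q → nonzeros (applyUpTo (λ _ → 0) q) ≡ []
nonzeros-zeros zero    = refl
nonzeros-zeros (suc q) = nonzeros-zeros q

nonzeros-bump : ∀ {p q} → p < q → nonzeros (applyUpTo (bump p (λ _ → 0)) q) ≡ 1 ∷ []
nonzeros-bump {zero}  {suc q} _         = cong (1 ∷_) (nonzeros-zeros q)
nonzeros-bump {suc p} {suc q} (s≤s p<q) = nonzeros-bump p<q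

nonzeros-++ : ∀ us vs → nonzeros (us ++ vs) ≡ nonzeros us ++ nonzeros vs
nonzeros-++ []           vs = refl
nonzeros-++ (zero  ∷ us) vs = nonzeros-++ us vs
nonzeros-++ (suc u ∷ us) vs = cong (suc u ∷_) (nonzeros-++ us vs)

≡ᵇ-< : ∀ {v w} → v < w → (v ≡ᵇ w) ≡ false
≡ᵇ-< {zero}  {suc w} _         = refl
≡ᵇ-< {suc v} {suc w} (s≤s v<w) = ≡ᵇ-< v<w

occ-absent : ∀ {w vs} → All (_< w) vs → occ w vs ≡ 0
occ-absent []         = refl
occ-absent (v<w ∷ ps) rewrite ≡ᵇ-< v<w = occ-absent ps

-- Six visible successors let comparisons of the first entry with the values up to 5, and its test
-- for zero, reduce by computation.
word-big : ∀ k {m} μ → m ≤ 5 → word (11 + k) (m , μ) ≡ 6 + (5 + k ∸ m) ∷ μ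
word-big k μ m≤5 = cong (_∷ μ) (+-∸-assoc 6 (≤-trans m≤5 (m≤m+n 5 k)))

-- The entry n - m ≥ 6 is larger than all others, so it is counted once and separately.
coreStep-word : ∀ k σ → Tame σ → coreStep (11 + k) (word (11 + k) σ) ≡ word (11 + k) (nextShape σ)
coreStep-word k (m , μ) ((1≤m , m≤5) , l≤5 , μ≤5) = begin
  coreStep (11 + k) (word (11 + k) (m , μ))
    ≡⟨ cong (coreStep (11 + k)) (word-big k μ m≤5) ⟩
  coreStep (11 + k) (6 + p ∷ μ)
    ≡⟨⟩
  nonzeros (word (11 + k) (suc (length μ) , tally μ 5 ++ applyUpTo (bump p (λ j → occ (6 + j) μ)) (5 + k)))
    ≡⟨ cong nonzeros (word-big k _ l≤5) ⟩
  6 + _ ∷ nonzeros (tally μ 5 ++ applyUpTo (bump p (λ j → occ (6 + j) μ)) (5 + k))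
    ≡⟨ cong (6 + _ ∷_) tail ⟩
  6 + _ ∷ nonzeros (tally μ 5) ++ 1 ∷ []
    ≡⟨ word-big k _ l≤5 ⟨
  word (11 + k) (nextShape (m , μ))
    ∎
  where
  open ≡-Reasoning
  p = 5 + k ∸ m
  p<5+k : p < 5 + k
  p<5+k = ∸-monoʳ-< {5 + k} {m} {0} 1≤m (≤-trans m≤5 (m≤m+n 5 k))

  absent : ∀ j → occ (6 + j) μ ≡ 0
  absent j = occ-absent (All.map (λ v≤5 → s≤s (≤-trans v≤5 (m≤m+n 5 j))) μ≤5)

  tail : nonzeros (tally μ 5 ++ applyUpTo (bump p (λ j → occ (6 + j) μ)) (5 + k)) ≡ nonzeros (tally μ 5) ++ 1 ∷ []
  tail = trans (nonzeros-++ (tally μ 5) _) (cong (nonzeros (tally μ 5) ++_)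
    (trans (cong nonzeros (applyUpTo-cong (λ j → cong (λ c → bump p (λ _ → c) j) (absent j)) (5 + k)))
           (nonzeros-bump p<5+k)))

iterate-word : ∀ k t σ → TameFor t σ →
  iterate (coreStep (11 + k)) (word (11 + k) σ) t ≡ word (11 + k) (iterate nextShape σ t)
iterate-word k zero    σ _        = refl
iterate-word k (suc t) σ (p , ps) = trans
  (cong (λ vs → iterate (coreStep (11 + k)) vs t) (coreStep-word k σ p))
  (iterate-word k t (nextShape σ) ps)

-- `Settled` does not mention `k`, so one finite check of the 15 shapes serves all n ≥ 11.
settles-big : ∀ k → All (Settles (11 + k)) shapes
settles-big k = All.map settle (from-yes (all? settled? shapes))
  where
  Settled : Shape → Set
  Settled σ = nonzeros (proj₂ σ) ≡ proj₂ σ × TameFor 6 σ × iterate nextShape σ 6 ∈ cycleShapes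

  settled? : ∀ σ → Dec (Settled σ)
  settled? σ = ≡-dec _≟_ _ _ ×-dec tameFor? 6 σ ×-dec member? (×-≡-dec _≟_ (≡-dec _≟_)) _ cycleShapes

  settle : ∀ {σ} → Settled σ → Settles (11 + k) σ
  settle {m , μ} (nz , tame@(((_ , m≤5) , _) , _) , ∈cycle) =
    subst (_∈ cycleCores (11 + k))
          (sym (trans (cong (λ vs → iterate (coreStep (11 + k)) vs 6) nz-word) (iterate-word k 6 _ tame)))
          (∈-map⁺ (word (11 + k)) ∈cycle)
    where
    open ≡-Reasoning
    nz-word : nonzeros (word (11 + k) (m , μ)) ≡ word (11 + k) (m , μ)
    nz-word = begin
      nonzeros (word (11 + k) (m , μ)) ≡⟨ cong nonzeros (word-big k μ m≤5) ⟩
      6 + _ ∷ nonzeros μ               ≡⟨ cong (6 + _ ∷_) nz ⟩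
      6 + _ ∷ μ                        ≡⟨ word-big k μ m≤5 ⟨
      word (11 + k) (m , μ)            ∎

settles : ∀ n → n ≥ 4 → All (Settles n) shapes
settles 0 ()
settles 1 (s≤s ())
settles 2 (s≤s (s≤s ()))
settles 3 (s≤s (s≤s (s≤s ())))
settles 4  _ = from-yes (settles? 4)
settles 5  _ = from-yes (settles? 5)
settles 6  _ = from-yes (settles? 6)
settles 7  _ = from-yes (settles? 7)
settles 8  _ = from-yes (settles? 8)
settles 9  _ = from-yes (settles? 9)
settles 10 _ = from-yes (settles? 10)
settles (suc (suc (suc (suc (suc (suc (suc (suc (suc (suc (suc k))))))))))) _ = settles-big k

-- Sets of chains closed under predecessors

core-step : ∀ {n} (x y : Chain n) → x ↦ₛ y → core y ≡ coreStep n (core x)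
core-step x y x↦y = cong nonzeros (↦ₛ⇒profile x y x↦y)

-- Every cycle is such a set `S`, whatever its length, so perfect, amicable and sociable chains are
-- treated together.
module Recurrent {q} (n≥4 : suc q ≥ 4) (S : Chain (suc q) → Set)
                 (predecessor : ∀ {y} → S y → ∃[ x ] (S x × x ↦ₛ y)) where

  private
    n = suc q

  core-positive : ∀ (x : Chain n) → All (0 <_) (core x)
  core-positive x = nonzeros-positive (entries x)

  core-bounded : ∀ (x : Chain n) → All (_< n) (core x)
  core-bounded x = nonzeros⁺ (entries-bounded x)

  descend : ∀ e → (∀ {y} → S y → length (core y) ≤ e + 4) → ∀ {y} → S y → length (core y) ≤ 4
  descend zero    bnd = bnd
  -- The bound drops only after two counting steps, so it is applied to the predecessor of a
  -- predecessor of `z`.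
  descend (suc e) bnd = descend e λ {z} Sz →
    let y , Sy , y↦z = predecessor Sz
        x , Sx , x↦y = predecessor Sy
    in subst (_≤ e + 4) (cong length (sym (trans (core-step y z y↦z) (cong (coreStep n) (core-step x y x↦y)))))
         (subst (length (coreStep n (coreStep n (core x))) ≤_) (+-comm 4 e)
           (length-coreStep² q e (core x) (core-positive x) (core-bounded x)
             (subst (length (core x) ≤_) (cong suc (+-comm e 4)) (bnd Sx))))

  length-core≤4 : ∀ {y} → S y → length (core y) ≤ 4
  length-core≤4 = descend n λ {y} _ →
    ≤-trans (length-nonzeros (entries y)) (≤-trans (≤-reflexive (length-entries y)) (m≤m+n n 4))

  -- The all-zero chain has zero count n, which is not an admissible entry of `y`.
  core-nonempty : ∀ (x y : Chain n) → x ↦ₛ y → 1 ≤ length (core x)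
  core-nonempty x y x↦y with core x | ↦ₛ⇒profile x y x↦y
  ... | _ ∷ _ | _  = s≤s z≤n
  ... | []    | eq = case subst (All (_< n)) eq (entries-bounded y) of λ where
    (n<n ∷ _) → contradiction n<n (n≮n n)

  core-shape : ∀ {y} → S y → ∃[ σ ] (σ ∈ shapes × core y ≡ nonzeros (word n σ))
  core-shape {y} Sy =
    let x , Sx , x↦y = predecessor Sy
        τ = tally (core x) q
    in (length (core x) , nonzeros τ)
     , ∈-shapes (nonzeros-positive τ)
                (trans (sum-nonzeros τ) (sum-tally (core-positive x) (core-bounded x)))
                (core-nonempty x y x↦y) (length-core≤4 Sx)
     , trans (core-step x y x↦y) (nonzeros-∷ (n ∸ length (core x)) τ)
    where
    nonzeros-∷ : ∀ v vs → nonzeros (v ∷ vs) ≡ nonzeros (v ∷ nonzeros vs)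
    nonzeros-∷ zero    vs = sym (nonzeros-idem vs)
    nonzeros-∷ (suc v) vs = cong (suc v ∷_) (sym (nonzeros-idem vs))

  ancestor : ∀ t {y} → S y → ∃[ x ] (S x × core y ≡ iterate (coreStep n) (core x) t)
  ancestor zero    {y} Sy = y , Sy , refl
  ancestor (suc t) Sy =
    let x , Sx , eq  = ancestor t Sy
        w , Sw , w↦x = predecessor Sx
    in w , Sw , trans eq (cong (λ vs → iterate (coreStep n) vs t) (core-step w x w↦x))

  -- Six steps back there is still a member of `S`; it has a candidate shape, and six steps forward
  -- from it reach a listed cycle.
  core∈cycleCores : ∀ {y} → S y → core y ∈ cycleCores n
  core∈cycleCores Sy =
    let x , Sx , eq     = ancestor 6 Sy
        σ , σ∈ , x-word = core-shape Sx
    in subst (_∈ cycleCores n) (sym (trans eq (cong (λ vs → iterate (coreStep n) vs 6) x-word)))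
             (lookup (settles n n≥4) σ∈)

-- The cycles

-- The unit keeps its distance from the right end, so the `k` additional cells are zeroes in front.
-- They form the block inserted by `pad`.
applyUpTo-bump : ∀ c l k →
  applyUpTo (bump (c + k) (λ _ → 0)) (l + k) ≡ replicate k 0 ++ applyUpTo (bump c (λ _ → 0)) l
applyUpTo-bump c l zero rewrite +-identityʳ c | +-identityʳ l = refl
applyUpTo-bump c l (suc k) rewrite +-suc c k | +-suc l k = cong (0 ∷_) (applyUpTo-bump c l k)

-- The counting operator on entry lists: `x ↦ₛ y` amounts to `entries y ≡ next n (entries x)`.
next : ℕ → List ℕ → List ℕ
next n u = profile n (nonzeros u)

perfect-profile : ∀ k → profile (7 + k) (3 + k ∷ 2 ∷ 1 ∷ 1 ∷ []) ≡
  pad (7 + k) (3 + k ∷ 2 ∷ 1 ∷ []) (1 ∷ 0 ∷ 0 ∷ 0 ∷ [])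
perfect-profile k = cong (λ vs → 3 + k ∷ 2 ∷ 1 ∷ vs) (applyUpTo-bump 0 4 k)

amicable-profileˡ : ∀ k → profile (8 + k) (5 + k ∷ 1 ∷ 1 ∷ 1 ∷ []) ≡
  pad (8 + k) (4 + k ∷ 3 ∷ 0 ∷ 0 ∷ []) (0 ∷ 1 ∷ 0 ∷ 0 ∷ [])
amicable-profileˡ k = cong (λ vs → 4 + k ∷ 3 ∷ 0 ∷ 0 ∷ vs) (applyUpTo-bump 1 4 k)

amicable-profileʳ : ∀ k → profile (8 + k) (4 + k ∷ 3 ∷ 1 ∷ []) ≡
  pad (8 + k) (5 + k ∷ 1 ∷ 0 ∷ 1 ∷ []) (1 ∷ 0 ∷ 0 ∷ 0 ∷ [])
amicable-profileʳ k = cong (λ vs → 5 + k ∷ 1 ∷ 0 ∷ 1 ∷ vs) (applyUpTo-bump 0 4 k)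

next-perfect : ∀ {n u} → PerfectTuple n u → next n u ≡ u
next-perfect perfect₄  = refl
next-perfect perfect₄′ = refl
next-perfect perfect₅  = refl
next-perfect (perfectₙ (s≤s (s≤s (s≤s (s≤s (s≤s (s≤s (s≤s (z≤n {k})))))))))
  rewrite nonzeros-replicate k (1 ∷ 0 ∷ 0 ∷ 0 ∷ []) = perfect-profile k

next-amicableˡ : ∀ {n u v} → AmicableTuples n u v → next n u ≡ v
next-amicableˡ amicable₆ = refl
next-amicableˡ (amicableₙ (s≤s (s≤s (s≤s (s≤s (s≤s (s≤s (s≤s (s≤s (z≤n {k}))))))))))
  rewrite nonzeros-replicate k (0 ∷ 1 ∷ 0 ∷ 0 ∷ []) = amicable-profileʳ k

next-amicableʳ : ∀ {n u v} → AmicableTuples n u v → next n v ≡ u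
next-amicableʳ amicable₆ = refl
next-amicableʳ (amicableₙ (s≤s (s≤s (s≤s (s≤s (s≤s (s≤s (s≤s (s≤s (z≤n {k}))))))))))
  rewrite nonzeros-replicate k (1 ∷ 0 ∷ 0 ∷ 0 ∷ []) = amicable-profileˡ k

amicable-≢ : ∀ {n u v} → AmicableTuples n u v → u ≢ v
amicable-≢ amicable₆ ()
amicable-≢ (amicableₙ (s≤s (s≤s (s≤s (s≤s (s≤s (s≤s (s≤s (s≤s (z≤n {k})))))))))) eq =
  1+n≢n (sym (∷-injectiveˡ eq))

-- The constructors correspond to the periods 1, 2 and 3. Each classification later keeps one of
-- them and excludes the others by its period.
data Cyclic (n : ℕ) (u : List ℕ) : Set where
  fixed   : PerfectTuple n u → Cyclic n u
  swapped : ∀ {v} → AmicableTuples n u v ⊎ AmicableTuples n v u → Cyclic n u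
  rotated : n ≡ 7 → u ∈ sociable₇ → Cyclic n u

-- The tuple `profile n c` is the successor of a chain with nonzero entries `c`, so the answers are
-- shifted by one place along each cycle.
cyclic : ∀ {n c} → n ≥ 4 → c ∈ cycleCores n → Cyclic n (profile n c)
cyclic {1} (s≤s ()) _
cyclic {2} (s≤s (s≤s ())) _
cyclic {3} (s≤s (s≤s (s≤s ()))) _
cyclic {4} _ (here refl)                         = fixed perfect₄
cyclic {4} _ (there (here refl))                 = fixed perfect₄′
cyclic {5} _ (here refl)                         = fixed perfect₅
cyclic {6} _ (here refl)                         = swapped (inj₂ amicable₆)
cyclic {6} _ (there (here refl))                 = swapped (inj₁ amicable₆)
cyclic {7} _ (here refl)                         = fixed (perfectₙ ≤-refl)
cyclic {7} _ (there (here refl))                 = rotated refl (there (here refl))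
cyclic {7} _ (there (there (here refl)))         = rotated refl (there (there (here refl)))
cyclic {7} _ (there (there (there (here refl)))) = rotated refl (here refl)
cyclic {suc (suc (suc (suc (suc (suc (suc (suc k)))))))} _ (here refl) =
  subst (Cyclic (8 + k)) (sym (perfect-profile (suc k))) (fixed (perfectₙ (m≤m+n 7 (suc k))))
cyclic {suc (suc (suc (suc (suc (suc (suc (suc k)))))))} _ (there (here refl)) =
  subst (Cyclic (8 + k)) (sym (amicable-profileʳ k)) (swapped (inj₂ (amicableₙ (m≤m+n 8 k))))
cyclic {suc (suc (suc (suc (suc (suc (suc (suc k)))))))} _ (there (there (here refl))) =
  subst (Cyclic (8 + k)) (sym (amicable-profileˡ k)) (swapped (inj₁ (amicableₙ (m≤m+n 8 k))))

-- The nonzero entries of a predecessor determine the whole chain, positions included; those of `y`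
-- itself would not show where its zeroes are.
recurrent-cyclic : ∀ {n} → n ≥ 4 → (S : Chain n → Set) → (∀ {y} → S y → ∃[ x ] (S x × x ↦ₛ y)) →
  ∀ {y} → S y → Cyclic n (entries y)
recurrent-cyclic {suc q} n≥4 S predecessor {y} Sy =
  let x , Sx , x↦y = predecessor Sy
  in subst (Cyclic (suc q)) (sym (↦ₛ⇒profile x y x↦y))
       (cyclic n≥4 (Recurrent.core∈cycleCores n≥4 S predecessor Sx))

-- Chains with the listed entries

realise-dec : ∀ {n} u → {True (length u ≟ n ×-dec all? (_<? n) u)} → ∃[ x ] entries {n} x ≡ u
realise-dec u {t} = let len , bnd = toWitness t in realise u len bnd

realise-pad : ∀ {n us vs} → length us + length vs ≤ n → All (_< n) us → 0 < n → All (_< n) vs →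
  ∃[ x ] entries {n} x ≡ pad n us vs
realise-pad {n} {us} {vs} le bu 0<n bv = realise (pad n us vs) len (++⁺ bu (++⁺ (replicate⁺ r 0<n) bv))
  where
  open ≡-Reasoning
  r = n ∸ (length us + length vs)
  len : length (pad n us vs) ≡ n
  len = begin
    length (us ++ replicate r 0 ++ vs)           ≡⟨ length-++ us ⟩
    length us + length (replicate r 0 ++ vs)     ≡⟨ cong (length us +_) (length-++ (replicate r 0)) ⟩
    length us + (length (replicate r 0) + length vs)
      ≡⟨ cong (λ t → length us + (t + length vs)) (length-replicate r) ⟩
    length us + (r + length vs)                  ≡⟨ cong (length us +_) (+-comm r (length vs)) ⟩
    length us + (length vs + r)                  ≡⟨ +-assoc (length us) (length vs) r ⟨
    length us + length vs + r                    ≡⟨ m+[n∸m]≡n le ⟩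
    n                                            ∎

realise-perfect : ∀ {n u} → PerfectTuple n u → ∃[ x ] entries {n} x ≡ u
realise-perfect perfect₄  = realise-dec _
realise-perfect perfect₄′ = realise-dec _
realise-perfect perfect₅  = realise-dec _
realise-perfect (perfectₙ n≥7@(s≤s (s≤s (s≤s (s≤s (s≤s (s≤s (s≤s (z≤n {k}))))))))) =
  realise-pad n≥7 (m≤n+m (4 + k) 3 ∷ m≤m+n 3 (4 + k) ∷ m≤m+n 2 (5 + k) ∷ []) (s≤s z≤n)
    (m≤m+n 2 (5 + k) ∷ s≤s z≤n ∷ s≤s z≤n ∷ s≤s z≤n ∷ [])

realise-amicable : ∀ {n u v} → AmicableTuples n u v →
  (∃[ x ] entries {n} x ≡ u) × (∃[ y ] entries {n} y ≡ v)
realise-amicable amicable₆ =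
  realise-dec _ , realise-dec _
realise-amicable (amicableₙ n≥8@(s≤s (s≤s (s≤s (s≤s (s≤s (s≤s (s≤s (s≤s (z≤n {k})))))))))) =
    realise-pad n≥8 (m≤n+m (5 + k) 3 ∷ m≤m+n 4 (4 + k) ∷ s≤s z≤n ∷ s≤s z≤n ∷ []) (s≤s z≤n)
      (s≤s z≤n ∷ m≤m+n 2 (6 + k) ∷ s≤s z≤n ∷ s≤s z≤n ∷ [])
  , realise-pad n≥8 (m≤n+m (6 + k) 2 ∷ m≤m+n 2 (6 + k) ∷ s≤s z≤n ∷ m≤m+n 2 (6 + k) ∷ []) (s≤s z≤n)
      (m≤m+n 2 (6 + k) ∷ s≤s z≤n ∷ s≤s z≤n ∷ s≤s z≤n ∷ [])

realise-sociable : ∀ {u} → u ∈ sociable₇ → ∃[ x ] entries {7} x ≡ u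
realise-sociable (here refl)                 = realise-dec _
realise-sociable (there (here refl))         = realise-dec _
realise-sociable (there (there (here refl))) = realise-dec _

-- Periods of the listed cycles

next-sociable : ∀ {u} → u ∈ sociable₇ → next 7 u ∈ sociable₇
next-sociable (here refl)                 = there (here refl)
next-sociable (there (here refl))         = there (there (here refl))
next-sociable (there (there (here refl))) = here refl

next³-sociable : ∀ {u} → u ∈ sociable₇ → next 7 (next 7 (next 7 u)) ≡ u
next³-sociable (here refl)                 = refl
next³-sociable (there (here refl))         = refl
next³-sociable (there (there (here refl))) = refl

next-sociable-≢ : ∀ {u} → u ∈ sociable₇ → next 7 u ≢ u
next-sociable-≢ (here refl)                 ()
next-sociable-≢ (there (here refl))         ()
next-sociable-≢ (there (there (here refl))) ()

next²-sociable-≢ : ∀ {u} → u ∈ sociable₇ → next 7 (next 7 u) ≢ u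
next²-sociable-≢ (here refl)                 ()
next²-sociable-≢ (there (here refl))         ()
next²-sociable-≢ (there (there (here refl))) ()

orbit : List ℕ → List (List ℕ)
orbit u = u ∷ next 7 u ∷ next 7 (next 7 u) ∷ []

orbit-rotation : ∀ {u} → u ∈ sociable₇ → IsRotation sociable₇ (orbit u)
orbit-rotation (here refl)                 = [] , _ , refl , refl
orbit-rotation (there (here refl))         = _ ∷ [] , _ ∷ _ ∷ [] , refl , refl
orbit-rotation (there (there (here refl))) = _ ∷ _ ∷ [] , _ ∷ [] , refl , refl

rotation-orbit : ∀ {us} → IsRotation sociable₇ us → ∃[ u ] (u ∈ sociable₇ × us ≡ orbit u)
rotation-orbit ([]               , _  , refl , refl) = _ , here refl , refl
rotation-orbit (_ ∷ []           , _  , refl , refl) = _ , there (here refl) , refl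
rotation-orbit (_ ∷ _ ∷ []       , _  , refl , refl) = _ , there (there (here refl)) , refl
-- Cutting after the last entry is the trivial rotation again.
rotation-orbit (_ ∷ _ ∷ _ ∷ []   , [] , refl , refl) = _ , here refl , refl

cyclic-perfect : ∀ {n u} → Cyclic n u → next n u ≡ u → PerfectTuple n u
cyclic-perfect (fixed p)          _  = p
cyclic-perfect (swapped (inj₁ a)) eq = contradiction (trans (sym eq) (next-amicableˡ a)) (amicable-≢ a)
cyclic-perfect (swapped (inj₂ a)) eq = contradiction (trans (sym (next-amicableʳ a)) eq) (amicable-≢ a)
cyclic-perfect (rotated refl u∈)  eq = contradiction eq (next-sociable-≢ u∈)

cyclic-amicable : ∀ {n u v} → Cyclic n u → next n u ≡ v → next n v ≡ u → u ≢ v →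
  AmicableTuples n u v ⊎ AmicableTuples n v u
cyclic-amicable (fixed p)          refl _  u≢v = contradiction (sym (next-perfect p)) u≢v
cyclic-amicable (swapped (inj₁ a)) refl _  _   = inj₁ (subst (AmicableTuples _ _) (sym (next-amicableˡ a)) a)
cyclic-amicable (swapped (inj₂ a)) refl _  _   =
  inj₂ (subst (λ v → AmicableTuples _ v _) (sym (next-amicableʳ a)) a)
cyclic-amicable (rotated refl u∈)  refl eq _   = contradiction eq (next²-sociable-≢ u∈)

cyclic-sociable : ∀ {n u} → Cyclic n u → next n u ≢ u → next n (next n u) ≢ u → n ≡ 7 × u ∈ sociable₇
cyclic-sociable (fixed p)          ≢₁ _  = contradiction (next-perfect p) ≢₁
cyclic-sociable {n} (swapped (inj₁ a)) _  ≢₂ =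
  contradiction (trans (cong (next n) (next-amicableˡ a)) (next-amicableʳ a)) ≢₂
cyclic-sociable {n} (swapped (inj₂ a)) _  ≢₂ =
  contradiction (trans (cong (next n) (next-amicableʳ a)) (next-amicableˡ a)) ≢₂
cyclic-sociable (rotated n≡7 u∈)   _  _  = n≡7 , u∈

-- Classification of perfect, amicable and sociable chains

perfect⇔ : ∀ {n} → n ≥ 4 → ∀ u → (∃[ x ] (entries {n} x ≡ u × Perfect x)) ⇔ PerfectTuple n u
perfect⇔ {n} n≥4 u = mk⇔ to from
  where
  to : (∃[ x ] (entries {n} x ≡ u × Perfect x)) → PerfectTuple n u
  to (x , refl , x↦x) =
    -- The singleton of `x` is closed under predecessors, since `x` precedes itself.
    cyclic-perfect (recurrent-cyclic n≥4 (_≡ x) (λ where refl → x , refl , x↦x) refl)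
                   (sym (↦ₛ⇒profile x x x↦x))

  from : PerfectTuple n u → ∃[ x ] (entries {n} x ≡ u × Perfect x)
  from p with realise-perfect p
  ... | x , refl = x , refl , profile⇒↦ₛ x x (sym (next-perfect p))

amicable⇔ : ∀ {n} → n ≥ 4 → ∀ u v →
  (∃[ x ] ∃[ y ] (entries {n} x ≡ u × entries {n} y ≡ v × Amicable x y))
    ⇔ (AmicableTuples n u v ⊎ AmicableTuples n v u)
amicable⇔ {n} n≥4 u v = mk⇔ to from
  where
  Pair : List ℕ → List ℕ → Set
  Pair u v = ∃[ x ] ∃[ y ] (entries {n} x ≡ u × entries {n} y ≡ v × Amicable x y)

  to : Pair u v → AmicableTuples n u v ⊎ AmicableTuples n v u
  to (x , y , refl , refl , x≢y , x↦y , y↦x) =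
    cyclic-amicable (recurrent-cyclic n≥4 (λ z → z ≡ x ⊎ z ≡ y) predecessor (inj₁ refl))
      (sym (↦ₛ⇒profile x y x↦y)) (sym (↦ₛ⇒profile y x y↦x)) (x≢y ∘ toℕs-injective x y)
    where
    predecessor : ∀ {z} → z ≡ x ⊎ z ≡ y → ∃[ w ] ((w ≡ x ⊎ w ≡ y) × w ↦ₛ z)
    predecessor (inj₁ refl) = y , inj₂ refl , y↦x
    predecessor (inj₂ refl) = x , inj₁ refl , x↦y

  pair : ∀ {u v} → AmicableTuples n u v → Pair u v
  pair a with realise-amicable a
  ... | (x , refl) , (y , refl) = x , y , refl , refl
    , amicable-≢ a ∘ cong entries
    , profile⇒↦ₛ x y (sym (next-amicableˡ a))
    , profile⇒↦ₛ y x (sym (next-amicableʳ a))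

  from : AmicableTuples n u v ⊎ AmicableTuples n v u → Pair u v
  from (inj₁ a) = pair a
  from (inj₂ a) = let x , y , x≡ , y≡ , x≢y , x↦y , y↦x = pair a in
    y , x , y≡ , x≡ , x≢y ∘ sym , y↦x , x↦y

-- Writing the length as `3 + l` exposes the first three chains. Their distinctness rules out the
-- periods 1 and 2, for every length at once.
module SociableSteps {n l} {x : Fin (3 + l) → Chain n} (soc : Sociable x) where
  open Sociable soc

  u₀ : List ℕ
  u₀ = entries (x zero)

  entries-≢ : ∀ {i j} → i ≢ j → entries (x i) ≢ entries (x j)
  entries-≢ i≢j eq = i≢j (distinct (toℕs-injective _ _ eq))

  entries-step : ∀ i j → toℕ j ≡ suc (toℕ i) → entries (x j) ≡ next n (entries (x i))
  entries-step i j eq = ↦ₛ⇒profile (x i) (x j) (step i j eq)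

  entries₁ : entries (x (suc zero)) ≡ next n u₀
  entries₁ = entries-step zero (suc zero) refl

  entries₂ : entries (x (suc (suc zero))) ≡ next n (next n u₀)
  entries₂ = trans (entries-step (suc zero) (suc (suc zero)) refl) (cong (next n) entries₁)

  predecessor : ∀ {y} → ∃[ k ] y ≡ x k → ∃[ w ] ((∃[ k ] w ≡ x k) × w ↦ₛ y)
  -- The chain before the first is the last one, by `close`.
  predecessor (zero  , refl) = _ , (fromℕ (2 + l) , refl) , close _ _ (cong suc (toℕ-fromℕ (2 + l))) refl
  predecessor (suc k , refl) = _ , (inject₁ k , refl) , step _ _ (cong suc (sym (toℕ-inject₁ k)))

  start : n ≥ 4 → n ≡ 7 × u₀ ∈ sociable₇
  start n≥4 = cyclic-sociable
    (recurrent-cyclic n≥4 (λ y → ∃[ k ] y ≡ x k) predecessor (zero , refl))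
    (entries-≢ {suc zero} {zero} (λ ()) ∘ trans entries₁)
    (entries-≢ {suc (suc zero)} {zero} (λ ()) ∘ trans entries₂)

-- The first chain lies on the 3-cycle for n = 7, so the fourth would equal it, against
-- distinctness.
¬sociable>3 : ∀ {n} → n ≥ 4 → ∀ l → l > 3 → (x : Fin l → Chain n) → ¬ Sociable x
¬sociable>3 n≥4 _ (s≤s (s≤s (s≤s (s≤s z≤n)))) x soc with SociableSteps.start soc n≥4
... | refl , u₀∈ = entries-≢ {three} {zero} (λ ())
    (trans (entries-step two three refl) (trans (cong (next 7) entries₂) (next³-sociable u₀∈)))
  where
  open SociableSteps soc
  two three : Fin (4 + _)
  two   = suc (suc zero)
  three = suc (suc (suc zero))

sociable⇔ : ∀ {n} → n ≥ 4 → ∀ us →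
  (∃[ l ] ∃[ x ] (tabulate {n = l} (λ k → entries {n} (x k)) ≡ us × Sociable x))
    ⇔ (n ≡ 7 × IsRotation sociable₇ us)
sociable⇔ {n} n≥4 us = mk⇔ to from
  where
  to : ∃[ l ] ∃[ x ] (tabulate {n = l} (λ k → entries {n} (x k)) ≡ us × Sociable x) →
       n ≡ 7 × IsRotation sociable₇ us
  to (0 , _ , _ , soc) = contradiction (Sociable.l≥3 soc) λ ()
  to (1 , _ , _ , soc) = contradiction (Sociable.l≥3 soc) λ where (s≤s ())
  to (2 , _ , _ , soc) = contradiction (Sociable.l≥3 soc) λ where (s≤s (s≤s ()))
  to (3 , x , refl , soc) with SociableSteps.start soc n≥4
  ... | refl , u₀∈ = refl , subst (IsRotation sociable₇)
    (sym (cong₂ (λ v w → u₀ ∷ v ∷ w ∷ []) entries₁ entries₂)) (orbit-rotation u₀∈)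
    where open SociableSteps soc
  to (suc (suc (suc (suc l))) , x , _ , soc) =
    contradiction soc (¬sociable>3 n≥4 _ (m≤m+n 4 l) x)

  from : n ≡ 7 × IsRotation sociable₇ us →
         ∃[ l ] ∃[ x ] (tabulate {n = l} (λ k → entries {n} (x k)) ≡ us × Sociable x)
  from (refl , rot) with rotation-orbit rot
  ... | u , u∈ , refl with realise-sociable u∈ | realise-sociable (next-sociable u∈)
                         | realise-sociable (next-sociable (next-sociable u∈))
  ... | x₀ , refl | x₁ , eq₁ | x₂ , eq₂ = 3 , x
      , cong₂ (λ v w → entries x₀ ∷ v ∷ w ∷ []) eq₁ eq₂
      , record { l≥3 = ≤-refl ; distinct = distinct _ _ ; step = step ; close = close }
    where
    x : Fin 3 → Chain 7
    x zero             = x₀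
    x (suc zero)       = x₁
    x (suc (suc zero)) = x₂

    x₁≢x₀ : x₁ ≢ x₀
    x₁≢x₀ eq = next-sociable-≢ u∈ (trans (sym eq₁) (cong entries eq))

    x₂≢x₀ : x₂ ≢ x₀
    x₂≢x₀ eq = next²-sociable-≢ u∈ (trans (sym eq₂) (cong entries eq))

    x₂≢x₁ : x₂ ≢ x₁
    x₂≢x₁ eq = next-sociable-≢ (next-sociable u∈) (trans (sym eq₂) (trans (cong entries eq) eq₁))

    distinct : ∀ i j → x i ≡ x j → i ≡ j
    distinct zero             zero             _  = refl
    distinct zero             (suc zero)       eq = contradiction (sym eq) x₁≢x₀
    distinct zero             (suc (suc zero)) eq = contradiction (sym eq) x₂≢x₀
    distinct (suc zero)       zero             eq = contradiction eq x₁≢x₀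
    distinct (suc zero)       (suc zero)       _  = refl
    distinct (suc zero)       (suc (suc zero)) eq = contradiction (sym eq) x₂≢x₁
    distinct (suc (suc zero)) zero             eq = contradiction eq x₂≢x₀
    distinct (suc (suc zero)) (suc zero)       eq = contradiction eq x₂≢x₁
    distinct (suc (suc zero)) (suc (suc zero)) _  = refl

    step : ∀ i j → toℕ j ≡ suc (toℕ i) → x i ↦ₛ x j
    step zero       (suc zero)       _ = profile⇒↦ₛ x₀ x₁ eq₁
    step (suc zero) (suc (suc zero)) _ = profile⇒↦ₛ x₁ x₂ (trans eq₂ (cong (next 7) (sym eq₁)))
    step (suc (suc zero)) zero             ()
    step (suc (suc zero)) (suc zero)       ()
    step (suc (suc zero)) (suc (suc zero)) ()

    close : ∀ i j → suc (toℕ i) ≡ 3 → toℕ j ≡ 0 → x i ↦ₛ x j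
    close (suc (suc zero)) zero _ _ =
      profile⇒↦ₛ x₂ x₀ (trans (sym (next³-sociable u∈)) (cong (next 7) (sym eq₂)))

theorem4 : ∀ (n : ℕ) → n ≥ 4 →
    (∀ (u : List ℕ) →
    (∃[ x ] (entries {n} x ≡ u × Perfect x)) ⇔ PerfectTuple n u)
    ×
    (∀ (u v : List ℕ) →
    (∃[ x ] ∃[ y ] (entries {n} x ≡ u × entries {n} y ≡ v × Amicable x y))
    ⇔ (AmicableTuples n u v ⊎ AmicableTuples n v u))
    ×
    (∀ (us : List (List ℕ)) →
    (∃[ l ] ∃[ x ] (tabulate {n = l} (λ k → entries {n} (x k)) ≡ us × Sociable x))
    ⇔ (n ≡ 7 × IsRotation sociable₇ us))
    ×
    (∀ (l : ℕ) → l > 3 → (x : Fin l → Chain n) → ¬ Sociable x)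
theorem4 n n≥4 = perfect⇔ n≥4 , amicable⇔ n≥4 , sociable⇔ n≥4 , ¬sociable>3 n≥4
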